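{- For any set $\mathbf P$ of path axioms and any nested sequent $\Gamma$, $\Gamma$ is derivable in $\mathbf{SKt}+\mathbf P$ if and only if $\Gamma$ is derivable in $\mathbf{DKt}+\mathbf P$.
   Context: Formulae are in negation normal form over $a,\neg a,\lor,\land,\square,\blacksquare,\lozenge,\lozenge^{\bullet}$, where $\lozenge^{\bullet}$ is the past diamond (dual of $\blacksquare$). Nested sequents are multisets of formulae and structures $\circ\{\Gamma\}$, $\bullet\{\Delta\}$; $\Sigma[\,]$ is a context with holes at any depth. $\mathbf{SKt}$: $id$ ($\Gamma,a,\overline a$), $cut$, $\land$, $\lor$, $ctr$, $wk$, $rf$ (from $\Gamma,\circ\{\Delta\}$ infer $\bullet\{\Gamma\},\Delta$), $rp$ (from $\Gamma,\bullet\{\Delta\}$ infer $\circ\{\Gamma\},\Delta$), $\blacksquare$ (from $\Gamma,\bullet\{A\}$ infer $\Gamma,\blacksquare A$), $\square$ (from $\Gamma,\circ\{A\}$ infer $\Gamma,\square A$), $\lozenge^{\bullet}$ (from $\Gamma,\bullet\{\Delta,A\}$ infer $\Gamma,\bullet\{\Delta\},\lozenge^{\bullet}A$), $\lozenge$ (from $\Gamma,\circ\{\Delta,A\}$ infer $\Gamma,\circ\{\Delta\},\lozenge A$). A path axiom is a scheme $\langle?\rangle_1\cdots\langle?\rangle_n X\to\langle?\rangle X$ ($n\ge0$, each diamond $\lozenge$ or $\lozenge^{\bullet}$). $\mathbf{SKt}+\mathbf P$ adds for each axiom in $\mathbf P$ the structural rule: from $\Gamma,\star\{\Delta\}$ infer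 $\Gamma,\star_1\{\cdots\star_n\{\Delta\}\cdots\}$ ($\star$ is $\circ$ for $\lozenge$, $\bullet$ for $\lozenge^{\bullet}$). $\mathbf{DKt}$: $id$: $\Sigma[a,\overline a]$; $\land$: from $\Sigma[A\land B,A]$, $\Sigma[A\land B,B]$ infer $\Sigma[A\land B]$; $\lor$: from $\Sigma[A\lor B,A,B]$ infer $\Sigma[A\lor B]$; $\blacksquare$: from $\Sigma[\blacksquare A,\bullet\{A\}]$ infer $\Sigma[\blacksquare A]$; $\square$: from $\Sigma[\square A,\circ\{A\}]$ infer $\Sigma[\square A]$; $\lozenge^{\bullet}_1$: from $\Sigma[\bullet\{\Delta,A\},\lozenge^{\bullet}A]$ infer $\Sigma[\bullet\{\Delta\},\lozenge^{\bullet}A]$; $\lozenge^{\bullet}_2$: from $\Sigma[\circ\{\Delta,\lozenge^{\bullet}A\},A]$ infer $\Sigma[\circ\{\Delta,\lozenge^{\bullet}A\}]$; $\lozenge_1$: from $\Sigma[\circ\{\Delta,A\},\lozenge A]$ infer $\Sigma[\circ\{\Delta\},\lozenge A]$; $\lozenge_2$: from $\Sigma[\bullet\{\Delta,\lozenge A\},A]$ infer $\Sigma[\bullet\{\Delta,\lozenge A\}]$. For $\langle?\rangle\in\{\lozenge,\lozenge^{\bullet}\}$ let $\langle?\rangle^{ -1}$ be the other one. The inverted version $I(F)$ of $F=\langle?\rangle_1\cdots\langle?\rangle_n X\to\langle?\rangle X$ is $\langle?\rangle_n^{ -1}\cdots\langle?\rangle_1^{ -1}X\to\langle?\rangle^{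 -1}X$. If $F=\langle?\rangle_{F_1}\cdots\langle?\rangle_{F_m}X\to\langle?\rangle_F X$ and $G=\langle?\rangle_{G_1}\cdots\langle?\rangle_{G_n}X\to\langle?\rangle_G X$ with $\langle?\rangle_F=\langle?\rangle_{G_i}$, their composition at $i$ is $\langle?\rangle_{G_1}\cdots\langle?\rangle_{G_{i-1}}\langle?\rangle_{F_1}\cdots\langle?\rangle_{F_m}\langle?\rangle_{G_{i+1}}\cdots\langle?\rangle_{G_n}X\to\langle?\rangle_G X$. The completion $\mathbf Q^*$ of a set $\mathbf Q$ is the smallest superset containing $\lozenge X\to\lozenge X$ and $\lozenge^{\bullet}X\to\lozenge^{\bullet}X$ and closed under all compositions. For a nested sequent, view it as a tree whose nodes are multisets of formulae and whose edges are labelled $\circ$ or $\bullet$; its propagation graph has the same nodes and, for each $\circ$-child $n_1$ of $n$, an edge $n\to n_1$ labelled $\lozenge$ and $n_1\to n$ labelled $\lozenge^{\bullet}$, and for each $\bullet$-child $n_1$ of $n$, an edge $n\to n_1$ labelled $\lozenge^{\bullet}$ and $n_1\to n$ labelled $\lozenge$. $\mathbf{DKt}+\mathbf P$ is $\mathbf{DKt}$ plus all propagation rules: from $\Sigma[\langle?\rangle A]_i[A]_j$ infer $\Sigma[\langle?\rangle A]_i[\emptyset]_j$ (holes at nodes $i$ and $j$), whenever there is a path from $i$ to $j$ in the propagation graph whose sequence of labels $s$ satisfies $sX\to\langle?\rangle X\in(\mathbf P\cup I(\mathbf P))^*$. -}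

module Defs where

open import Data.Nat using (ℕ; zero; suc)
open import Data.List using (List; []; _∷_; _++_; map; reverse)
open import Data.Maybe using (Maybe; just; nothing)
open import Data.Product using (_×_; _,_; ∃)
open import Data.Sum using (_⊎_)
open import Relation.Binary.PropositionalEquality using (_≡_)
open import Data.List.Membership.Propositional using (_∈_)

-- Modalities.  fut = future (◇ / □ / ∘{}),  past = past (◇• / ■ / •{})

data Dia : Set where
  fut past : Dia

inv : Dia → Dia
inv fut  = past
inv past = fut

-- Formulae in negation normal form (atoms are natural numbers).
--   box fut A = □A,  box past A = ■A,  dia fut A = ◇A,  dia past A = ◇•A

data Fml : Set where
  atom  : ℕ → Fml
  natom : ℕ → Fml
  _∨'_  : Fml → Fml → Fml
  _∧'_  : Fml → Fml → Fml
  box   : Dia → Fml → Fml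
  dia   : Dia → Fml → Fml

neg : Fml → Fml
neg (atom a)  = natom a
neg (natom a) = atom a
neg (A ∨' B)  = neg A ∧' neg B
neg (A ∧' B)  = neg A ∨' neg B
neg (box d A) = dia d (neg A)
neg (dia d A) = box d (neg A)

-- Nested sequents: lists of items, considered up to (nested) permutation.
--   nest fut Δ = ∘{Δ},  nest past Δ = •{Δ}

data Item : Set where
  fml  : Fml → Item
  nest : Dia → List Item → Item

Seq : Set
Seq = List Item

mutual
  data _≈_ : Seq → Seq → Set where
    []    : [] ≈ []
    _∷_   : ∀ {x y xs ys} → x ≈I y → xs ≈ ys → (x ∷ xs) ≈ (y ∷ ys)
    swap  : ∀ x y xs → (x ∷ y ∷ xs) ≈ (y ∷ x ∷ xs)
    trans : ∀ {xs ys zs} → xs ≈ ys → ys ≈ zs → xs ≈ zs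

  data _≈I_ : Item → Item → Set where
    fmlI  : ∀ A → fml A ≈I fml A
    nestI : ∀ d {Γ Δ} → Γ ≈ Δ → nest d Γ ≈I nest d Δ

-- Path axioms  ⟨?⟩₁ ⋯ ⟨?⟩ₙ X → ⟨?⟩ X  represented as ([⟨?⟩₁,…,⟨?⟩ₙ] , ⟨?⟩)

PathAx : Set
PathAx = List Dia × Dia

I : PathAx → PathAx
I (ds , d) = reverse (map inv ds) , inv d

_∪I : (PathAx → Set) → PathAx → Set
(P ∪I) F = P F ⊎ ∃ λ G → P G × F ≡ I G

data Comp (Q : PathAx → Set) : PathAx → Set where
  base    : ∀ {F} → Q F → Comp Q F
  refl◇   : ∀ d → Comp Q (d ∷ [] , d)
  compose : ∀ {fs f gs₁ gs₂ g} →
            Comp Q (fs , f) → Comp Q (gs₁ ++ f ∷ gs₂ , g) →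
            Comp Q (gs₁ ++ fs ++ gs₂ , g)

nests : List Dia → Seq → Seq
nests []       Δ = Δ
nests (d ∷ ds) Δ = nest d (nests ds Δ) ∷ []

data SKt (P : PathAx → Set) : Seq → Set where
  id   : ∀ Γ a → SKt P (Γ ++ fml (atom a) ∷ fml (natom a) ∷ [])
  cut  : ∀ Γ A → SKt P (Γ ++ fml A ∷ []) → SKt P (Γ ++ fml (neg A) ∷ []) → SKt P Γ
  ∧r   : ∀ Γ A B → SKt P (Γ ++ fml A ∷ []) → SKt P (Γ ++ fml B ∷ []) →
         SKt P (Γ ++ fml (A ∧' B) ∷ [])
  ∨r   : ∀ Γ A B → SKt P (Γ ++ fml A ∷ fml B ∷ []) → SKt P (Γ ++ fml (A ∨' B) ∷ [])
  ctr  : ∀ Γ Δ → SKt P (Γ ++ Δ ++ Δ) → SKt P (Γ ++ Δ)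
  wk   : ∀ Γ Δ → SKt P Γ → SKt P (Γ ++ Δ)
  rf   : ∀ Γ Δ → SKt P (Γ ++ nest fut Δ ∷ []) → SKt P (nest past Γ ∷ Δ)
  rp   : ∀ Γ Δ → SKt P (Γ ++ nest past Δ ∷ []) → SKt P (nest fut Γ ∷ Δ)
  boxr : ∀ Γ d A → SKt P (Γ ++ nest d (fml A ∷ []) ∷ []) → SKt P (Γ ++ fml (box d A) ∷ [])
  diar : ∀ Γ Δ d A → SKt P (Γ ++ nest d (Δ ++ fml A ∷ []) ∷ []) →
         SKt P (Γ ++ nest d Δ ∷ fml (dia d A) ∷ [])
  path : ∀ Γ Δ ds d → P (ds , d) → SKt P (Γ ++ nest d Δ ∷ []) → SKt P (Γ ++ nests ds Δ)
  -- sequents are multisets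
  perm : ∀ {Γ Γ'} → Γ ≈ Γ' → SKt P Γ → SKt P Γ'

data Ctx : Set where
  hole   : Seq → Ctx
  inNest : Seq → Dia → Ctx → Ctx

plug : Ctx → Seq → Seq
plug (hole Γ)       Δ = Γ ++ Δ
plug (inNest Γ d c) Δ = Γ ++ nest d (plug c Δ) ∷ []

-- Nodes of the tree of a nested sequent, addressed by lists of
-- child positions, and the propagation graph.

Addr : Set
Addr = List ℕ

nth : Seq → ℕ → Maybe Item
nth []      _       = nothing
nth (x ∷ _) zero    = just x
nth (_ ∷ Γ) (suc k) = nth Γ k

node : Seq → Addr → Maybe Seq
node Γ              []          = just Γ
node []             (_ ∷ _)     = nothing
node (x ∷ Γ)        (suc k ∷ p) = node Γ (k ∷ p)
node (fml _ ∷ _)    (zero ∷ _)  = nothing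
node (nest _ Θ ∷ _) (zero ∷ p)  = node Θ p

addAt : Seq → Addr → Seq → Seq
addAt Γ              []          Δ = Γ ++ Δ
addAt []             (_ ∷ _)     Δ = []
addAt (x ∷ Γ)        (suc k ∷ p) Δ = x ∷ addAt Γ (k ∷ p) Δ
addAt (fml A ∷ Γ)    (zero ∷ _)  Δ = fml A ∷ Γ
addAt (nest d Θ ∷ Γ) (zero ∷ p)  Δ = nest d (addAt Θ p Δ) ∷ Γ

data Edge (Γ : Seq) : Addr → Dia → Addr → Set where
  down : ∀ {p Θ k d Δ} → node Γ p ≡ just Θ → nth Θ k ≡ just (nest d Δ) →
         Edge Γ p d (p ++ k ∷ [])
  up   : ∀ {p Θ k d Δ} → node Γ p ≡ just Θ → nth Θ k ≡ just (nest d Δ) →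
         Edge Γ (p ++ k ∷ []) (inv d) p

data Path (Γ : Seq) : Addr → List Dia → Addr → Set where
  []  : ∀ {p} → Path Γ p [] p
  _∷_ : ∀ {p d q s r} → Edge Γ p d q → Path Γ q s r → Path Γ p (d ∷ s) r

data DKt (P : PathAx → Set) : Seq → Set where
  id   : ∀ Σ a → DKt P (plug Σ (fml (atom a) ∷ fml (natom a) ∷ []))
  ∧r   : ∀ Σ A B → DKt P (plug Σ (fml (A ∧' B) ∷ fml A ∷ [])) →
         DKt P (plug Σ (fml (A ∧' B) ∷ fml B ∷ [])) → DKt P (plug Σ (fml (A ∧' B) ∷ []))
  ∨r   : ∀ Σ A B → DKt P (plug Σ (fml (A ∨' B) ∷ fml A ∷ fml B ∷ [])) →
         DKt P (plug Σ (fml (A ∨' B) ∷ []))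
  boxr : ∀ Σ d A → DKt P (plug Σ (fml (box d A) ∷ nest d (fml A ∷ []) ∷ [])) →
         DKt P (plug Σ (fml (box d A) ∷ []))
  dia₁ : ∀ Σ Δ d A → DKt P (plug Σ (nest d (Δ ++ fml A ∷ []) ∷ fml (dia d A) ∷ [])) →
         DKt P (plug Σ (nest d Δ ∷ fml (dia d A) ∷ []))
  dia₂ : ∀ Σ Δ d A → DKt P (plug Σ (nest (inv d) (Δ ++ fml (dia d A) ∷ []) ∷ fml A ∷ [])) →
         DKt P (plug Σ (nest (inv d) (Δ ++ fml (dia d A) ∷ []) ∷ []))
  prop : ∀ Γ i j s d A {Θ} → node Γ i ≡ just Θ → fml (dia d A) ∈ Θ →
         Path Γ i s j → Comp (P ∪I) (s , d) →
         DKt P (addAt Γ j (fml A ∷ [])) → DKt P Γ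
  -- sequents are multisets
  perm : ∀ {Γ Γ'} → Γ ≈ Γ' → DKt P Γ → DKt P Γ'

{-# OPTIONS --safe #-}

-- A sequent is read as a labelled sequent, i.e. a model of worlds, labelled edges and facts, and
-- both calculi are compared with a cut-free labelled calculus LKt whose diamond rule propagates
-- along walks.  Edges can be walked in both directions, so the display rules of SKt only move
-- the root, contraction only identifies worlds, and the path rule replaces an edge by a walk.
-- All of these are absorbed by one fact: LKt-derivations are preserved by maps of models sending
-- each edge to a walk allowed by the completion.  Cut is admissible in LKt by induction
-- on the cut formula; the box-diamond case is the same fact, applied to the map collapsing the
-- fresh world of the box onto the world reached by the diamond.  An LKt-derivation over the tree
-- of Γ is a DKt-derivation, since the box rule only attaches leaves.  Conversely, every context
-- can be displayed in SKt, which turns the deep rules into shallow ones, and propagation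
-- follows by cutting against the formulas ⟨s⟩A → ⟨d⟩A, which SKt + P proves for all
-- compositions, inverted axioms being obtained by displaying the far end of the path.
module Submission where

open import Defs
open import Data.Empty using (⊥)
open import Data.List using (List; []; _∷_; _++_; length; map; reverse; foldr)
open import Data.List.Properties
  using (++-assoc; ++-identityʳ; map-++; reverse-++; reverse-map; reverse-involutive;
         map-∘; map-cong; map-id; unfold-reverse; foldr-++)
open import Data.List.Membership.Propositional using (_∈_)
open import Data.List.Membership.Propositional.Properties using (∈-∃++; ∈-++⁺ʳ)
open import Data.List.Relation.Binary.Permutation.Propositional
  using (_↭_; refl; prep; swap; trans; ↭-sym; ↭-reflexive)
open import Data.List.Relation.Binary.Permutation.Propositional.Properties
  using (shift; ++-comm; ++⁺ʳ; ∷↭∷ʳ; ∈-resp-↭)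
open import Data.List.Relation.Unary.All using (All; []; _∷_)
open import Data.List.Relation.Unary.All.Properties using (++⁺; ++⁻)
open import Data.List.Relation.Unary.Any using (here; there)
open import Data.Maybe using (Maybe; just; nothing)
open import Data.Nat using (zero; suc)
open import Data.Product using (_×_; _,_; ∃; proj₁; proj₂)
open import Data.Sum using (_⊎_; inj₁; inj₂)
open import Function.Bundles using (_⇔_; mk⇔; Equivalence)
open import Function.Construct.Composition using (_⇔-∘_)
open import Relation.Binary.PropositionalEquality using (_≡_; refl; sym; cong; subst; module ≡-Reasoning)

open Equivalence using (to; from)

-- The labelled calculus and cut admissibility

inv-involutive : ∀ d → inv (inv d) ≡ d
inv-involutive fut  = refl
inv-involutive past = refl

converse : List Dia → List Dia
converse ds = reverse (map inv ds)

converse-++ : ∀ s t → converse (s ++ t) ≡ converse t ++ converse s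
converse-++ s t = begin
  reverse (map inv (s ++ t))         ≡⟨ cong reverse (map-++ inv s t) ⟩
  reverse (map inv s ++ map inv t)   ≡⟨ reverse-++ (map inv s) (map inv t) ⟩
  converse t ++ converse s           ∎
  where open ≡-Reasoning

converse-involutive : ∀ s → converse (converse s) ≡ s
converse-involutive s = begin
  reverse (map inv (reverse (map inv s)))   ≡⟨ cong reverse (reverse-map inv (map inv s)) ⟩
  reverse (reverse (map inv (map inv s)))   ≡⟨ reverse-involutive _ ⟩
  map inv (map inv s)                       ≡⟨ map-∘ s ⟨
  map (λ d → inv (inv d)) s                 ≡⟨ map-cong inv-involutive s ⟩
  map (λ d → d) s                           ≡⟨ map-id s ⟩
  s                                         ∎
  where open ≡-Reasoning

I-involutive : ∀ F → I (I F) ≡ F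
I-involutive (s , d) rewrite converse-involutive s | inv-involutive d = refl

record Model : Set₁ where
  constructor model
  field
    World : Set
    Edgeᴹ : World → Dia → World → Set
    Fact  : World → Fml → Set

open Model

-- A model stores an edge in one direction; this closure supplies the reversed edge with inverse
-- label, as in a propagation graph.
data Step {W : Set} (R : W → Dia → W → Set) : W → Dia → W → Set where
  fwd : ∀ {x d y} → R x d y → Step R x d y
  bwd : ∀ {x d y} → R x d y → Step R y (inv d) x

Step-sym : ∀ {W} {R : W → Dia → W → Set} {x d y} → Step R x d y → Step R y (inv d) x
Step-sym (fwd r)         = bwd r
Step-sym {R = R} (bwd {d = d} r) = fwd (subst (λ e → R _ e _) (sym (inv-involutive d)) r)

data Walk {W : Set} (R : W → Dia → W → Set) : W → List Dia → W → Set where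
  []  : ∀ {x} → Walk R x [] x
  _∷_ : ∀ {x d y s z} → Step R x d y → Walk R y s z → Walk R x (d ∷ s) z

_++ʷ_ : ∀ {W} {R : W → Dia → W → Set} {x s y t z} → Walk R x s y → Walk R y t z → Walk R x (s ++ t) z
[]      ++ʷ w = w
(r ∷ v) ++ʷ w = r ∷ (v ++ʷ w)

Walk-converse : ∀ {W} {R : W → Dia → W → Set} {x s y} → Walk R x s y → Walk R y (converse s) x
Walk-converse [] = []
Walk-converse {R = R} {x} {d ∷ s} {y} (r ∷ w) =
  subst (λ t → Walk R y t x) (sym (unfold-reverse (inv d) (map inv s)))
        (Walk-converse w ++ʷ (Step-sym r ∷ []))

data Lift {W : Set} (F : W → Fml → Set) : Maybe W → Fml → Set where
  old : ∀ {x A} → F x A → Lift F (just x) A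

-- `nothing` is the eigenvariable of the box rule, fresh by construction.
data Attach {W : Set} (R : W → Dia → W → Set) (x : W) (d : Dia) : Maybe W → Dia → Maybe W → Set where
  old : ∀ {y e z} → R y e z → Attach R x d (just y) e (just z)
  new : Attach R x d (just x) d nothing

data Insert {W : Set} (F : W → Fml → Set) (x : W) (A : Fml) : W → Fml → Set where
  old : ∀ {y B} → F y B → Insert F x A y B
  new : Insert F x A x A

data Connect {W : Set} (R : W → Dia → W → Set) (x : W) (d : Dia) (y : W) : W → Dia → W → Set where
  old : ∀ {u e v} → R u e v → Connect R x d y u e v
  new : Connect R x d y x d y

infixl 5 _,_∶_ _▸_,_

_,_∶_ : (M : Model) → World M → Fml → Model
M , x ∶ A = model (World M) (Edgeᴹ M) (Insert (Fact M) x A)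

_▸_,_ : (M : Model) → World M → Dia → Model
M ▸ x , d = model (Maybe (World M)) (Attach (Edgeᴹ M) x d) (Lift (Fact M))

connect : (M : Model) → World M → Dia → World M → Model
connect M x d y = model (World M) (Connect (Edgeᴹ M) x d y) (Fact M)

record _↪_ (N M : Model) : Set where
  field
    on   : World N → World M
    edge : ∀ {x d y} → Edgeᴹ N x d y → Edgeᴹ M (on x) d (on y)
    fact : ∀ {x A} → Fact N x A → Fact M (on x) A

open _↪_

insert↪ : ∀ {M x A} → M ↪ (M , x ∶ A)
insert↪ = record { on = λ x → x ; edge = λ r → r ; fact = old }

attach↪ : ∀ {M x d} → M ↪ (M ▸ x , d)
attach↪ = record { on = just ; edge = old ; fact = old }

connect↪ : ∀ {M x d y} → M ↪ connect M x d y
connect↪ = record { on = λ x → x ; edge = old ; fact = λ m → m }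

Step-map : ∀ {N M} (ι : N ↪ M) {x d y} → Step (Edgeᴹ N) x d y → Step (Edgeᴹ M) (on ι x) d (on ι y)
Step-map ι (fwd r) = fwd (edge ι r)
Step-map ι (bwd r) = bwd (edge ι r)

Walk-map : ∀ {N M} (ι : N ↪ M) {x s y} → Walk (Edgeᴹ N) x s y → Walk (Edgeᴹ M) (on ι x) s (on ι y)
Walk-map ι []      = []
Walk-map ι (r ∷ w) = Step-map ι r ∷ Walk-map ι w

module _ (P : PathAx → Set) where

  -- Inversion swaps `P` with its inverted axioms and sends a composition to a composition at the
  -- mirrored position. This allows linked edges to be walked backwards.
  Comp-I : ∀ {F} → Comp (P ∪I) F → Comp (P ∪I) (I F)
  Comp-I (base (inj₁ p)) = base (inj₂ (_ , p , refl))
  Comp-I (base (inj₂ (G , p , refl))) = base (inj₁ (subst P (sym (I-involutive G)) p))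
  Comp-I (refl◇ d) = refl◇ (inv d)
  Comp-I (compose {fs} {f} {gs₁} {gs₂} {g} c c′) =
    subst (λ s → Comp (P ∪I) (s , inv g)) (sym eq) (compose {gs₁ = converse gs₂} (Comp-I c)
      (subst (λ s → Comp (P ∪I) (s , inv g)) eq′ (Comp-I c′)))
    where
    open ≡-Reasoning
    eq : converse (gs₁ ++ fs ++ gs₂) ≡ converse gs₂ ++ converse fs ++ converse gs₁
    eq = begin
      converse (gs₁ ++ fs ++ gs₂)                   ≡⟨ converse-++ gs₁ (fs ++ gs₂) ⟩
      converse (fs ++ gs₂) ++ converse gs₁          ≡⟨ cong (_++ converse gs₁) (converse-++ fs gs₂) ⟩
      (converse gs₂ ++ converse fs) ++ converse gs₁ ≡⟨ ++-assoc (converse gs₂) _ _ ⟩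
      converse gs₂ ++ converse fs ++ converse gs₁   ∎
    eq′ : converse (gs₁ ++ f ∷ gs₂) ≡ converse gs₂ ++ inv f ∷ converse gs₁
    eq′ = begin
      converse (gs₁ ++ f ∷ gs₂)                     ≡⟨ converse-++ gs₁ (f ∷ gs₂) ⟩
      converse (f ∷ gs₂) ++ converse gs₁            ≡⟨ cong (_++ converse gs₁) (unfold-reverse (inv f) (map inv gs₂)) ⟩
      (converse gs₂ ++ inv f ∷ []) ++ converse gs₁  ≡⟨ ++-assoc (converse gs₂) _ _ ⟩
      converse gs₂ ++ inv f ∷ converse gs₁          ∎

  mutual
    -- Facts are never discarded, so weakening and contraction are built in. Either literal of an
    -- axiom may count as principal, which keeps the axiom case of cut symmetric.
    data LKt (M : Model) : Set where
      rule : ∀ {x A} → Fact M x A → Premises M x A → LKt M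

    data Premises (M : Model) (x : World M) : Fml → Set where
      atom  : ∀ {a} → Fact M x (natom a) → Premises M x (atom a)
      natom : ∀ {a} → Fact M x (atom a) → Premises M x (natom a)
      and   : ∀ {A B} → LKt (M , x ∶ A) → LKt (M , x ∶ B) → Premises M x (A ∧' B)
      or    : ∀ {A B} → LKt (M , x ∶ A , x ∶ B) → Premises M x (A ∨' B)
      box   : ∀ {d A} → LKt (M ▸ x , d , nothing ∶ A) → Premises M x (box d A)
      dia   : ∀ {d A s y} → Walk (Edgeᴹ M) x s y → Comp (P ∪I) (s , d) →
              LKt (M , y ∶ A) → Premises M x (dia d A)

  Linked : (M : Model) → World M → Dia → World M → Set
  Linked M x d y = ∃ λ s → Walk (Edgeᴹ M) x s y × Comp (P ∪I) (s , d)

  -- Facts of N with no counterpart in M are being eliminated; K is the evidence in M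
  -- from which a rule with such a principal fact is simulated.
  record Morph (K : (M : Model) → World M → Fml → Set) (N M : Model) : Set where
    field
      at   : World N → World M
      link : ∀ {x d y} → Edgeᴹ N x d y → Linked M (at x) d (at y)
      fact : ∀ {x A} → Fact N x A → Fact M (at x) A ⊎ K M (at x) A

    link-step : ∀ {x d y} → Step (Edgeᴹ N) x d y → Linked M (at x) d (at y)
    link-step (fwd r) = link r
    link-step (bwd r) with link r
    ... | s , w , c = converse s , Walk-converse w , Comp-I c

    -- `r` holds the labels already translated; each further step is one composition at the position
    -- right after `r`.
    link-walk : ∀ r {x s y d} → Walk (Edgeᴹ N) x s y → Comp (P ∪I) (r ++ s , d) →
                ∃ λ t → Walk (Edgeᴹ M) (at x) t (at y) × Comp (P ∪I) (r ++ t , d)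
    link-walk r [] c = [] , [] , c
    link-walk r {d = d} (_∷_ {s = s} e w) c with link-step e
    ... | t , v , c′ with link-walk (r ++ t) w
           (subst (λ q → Comp (P ∪I) (q , d)) (sym (++-assoc r t s)) (compose {gs₁ = r} c′ c))
    ... | t′ , v′ , c″ = t ++ t′ , v ++ʷ v′ , subst (λ q → Comp (P ∪I) (q , d)) (++-assoc r t t′) c″

  open Morph

  module Transform
    (K      : (M : Model) → World M → Fml → Set)
    (K-map  : ∀ {N M x A} (ι : N ↪ M) → K N x A → K M (on ι x) A)
    (reduce : ∀ {M x A} → K M x A → Premises M x A → LKt M)
    (clash  : ∀ {M x a} → K M x (atom a) → K M x (natom a) → LKt M)
    where

    insertᴹ : ∀ {N M A} (f : Morph K N M) {x} → Morph K (N , x ∶ A) (M , at f x ∶ A)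
    insertᴹ f .at = at f
    insertᴹ f .link = link f
    insertᴹ f .fact new = inj₁ new
    insertᴹ f .fact (old m) with fact f m
    ... | inj₁ m′ = inj₁ (old m′)
    ... | inj₂ k  = inj₂ (K-map insert↪ k)

    attachᴹ : ∀ {N M d} (f : Morph K N M) {x} → Morph K (N ▸ x , d) (M ▸ at f x , d)
    attachᴹ f .at (just x) = just (at f x)
    attachᴹ f .at nothing  = nothing
    attachᴹ {M = M} f .link (old r) with link f r
    ... | s , w , c = s , Walk-map (attach↪ {M}) w , c
    attachᴹ f .link new = _ , fwd new ∷ [] , refl◇ _
    attachᴹ f .fact (old m) with fact f m
    ... | inj₁ m′ = inj₁ (old m′)
    ... | inj₂ k  = inj₂ (K-map attach↪ k)

    resolve : ∀ {M x A} → Fact M x A ⊎ K M x A → Premises M x A → LKt M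
    resolve (inj₁ m) p = rule m p
    resolve (inj₂ k) p = reduce k p

    axiom : ∀ {M x a} → Fact M x (atom a) ⊎ K M x (atom a) → Fact M x (natom a) ⊎ K M x (natom a) → LKt M
    axiom m        (inj₁ m′) = resolve m (atom m′)
    axiom (inj₁ m) (inj₂ k)  = reduce k (natom m)
    axiom (inj₂ k) (inj₂ k′) = clash k k′

    -- By induction on the derivation. Premises are translated first, so `reduce` always receives
    -- premises living in the target model.
    transform : ∀ {N M} → Morph K N M → LKt N → LKt M
    transform f (rule m (atom m′))  = axiom (fact f m) (fact f m′)
    transform f (rule m (natom m′)) = axiom (fact f m′) (fact f m)
    transform f (rule m (and D E))  = resolve (fact f m) (and (transform (insertᴹ f) D) (transform (insertᴹ f) E))
    transform f (rule m (or D))     = resolve (fact f m) (or (transform (insertᴹ (insertᴹ f)) D))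
    transform f (rule m (box D))    = resolve (fact f m) (box (transform (insertᴹ (attachᴹ f)) D))
    transform f (rule m (dia w c D)) with link-walk f [] w c
    ... | _ , w′ , c′ = resolve (fact f m) (dia w′ c′ (transform (insertᴹ f) D))

  Hom : Model → Model → Set
  Hom = Morph (λ _ _ _ → ⊥)

  open Transform (λ _ _ _ → ⊥) (λ _ ()) (λ ()) (λ ())
    renaming (transform to LKt-map; insertᴹ to insertʰ; attachᴹ to attachʰ) using ()

  embed : ∀ {N M} → N ↪ M → Hom N M
  embed ι .at   = on ι
  embed ι .link r = _ , fwd (edge ι r) ∷ [] , refl◇ _
  embed ι .fact m = inj₁ (fact ι m)

  insert-map : ∀ {N M x A} (ι : N ↪ M) → LKt (N , x ∶ A) → LKt (M , on ι x ∶ A)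
  insert-map ι = LKt-map (insertʰ (embed ι))

  Premises-map : ∀ {N M x A} (ι : N ↪ M) → Premises N x A → Premises M (on ι x) A
  Premises-map ι (atom m)    = atom (fact ι m)
  Premises-map ι (natom m)   = natom (fact ι m)
  Premises-map ι (and D E)   = and (insert-map ι D) (insert-map ι E)
  Premises-map ι (or D)      = or (LKt-map (insertʰ (insertʰ (embed ι))) D)
  Premises-map ι (box D)     = box (LKt-map (insertʰ (attachʰ (embed ι))) D)
  Premises-map ι (dia w c D) = dia (Walk-map ι w) c (insert-map ι D)

  -- Substitutes `y` for the fresh world of a box; the new edge becomes the given walk from `x` to
  -- `y`.
  collapse : ∀ {M x d y A} → Linked M x d y → Hom (M ▸ x , d , nothing ∶ A) (M , y ∶ A)
  collapse l .at (just x) = x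
  collapse {y = y} l .at nothing = y
  collapse l .link (old r) = _ , fwd r ∷ [] , refl◇ _
  collapse l .link new = l
  collapse l .fact (old (old m)) = inj₁ (old m)
  collapse l .fact new = inj₁ new

  -- Both halves of a cut are eliminated this way: K is first the other premise of the cut, and
  -- then, at a rule principal in the first premise, the premises of that rule.
  cut-via : ∀ {M x A} → (K : (M : Model) → World M → Set) →
            (∀ {N M x} (ι : N ↪ M) → K N x → K M (on ι x)) →
            (∀ {M x} → K M x → Premises M x A → LKt M) →
            LKt (M , x ∶ A) → K M x → LKt M
  cut-via {M} {x} {A} K K-map reduce D k =
    Transform.transform (λ M x B → B ≡ A × K M x) (λ { ι (e , k) → e , K-map ι k })
      -- Only the single formula `A` is eliminated, and it cannot be both a positive and a negative
      -- literal, so a clash is impossible.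
      (λ { (refl , k) → reduce k }) (λ { (refl , _) (() , _) }) f D
    where
    f : Morph (λ M x B → B ≡ A × K M x) (M , x ∶ A) M
    f .at x = x
    f .link r = _ , fwd r ∷ [] , refl◇ _
    f .fact (old m) = inj₁ m
    f .fact new     = inj₂ (refl , k)

  mutual
    -- The cut formula alone decreases through these mutual calls; the inductions on the two
    -- derivations happen inside `transform`.
    cutᴸ : ∀ A {M x} → LKt (M , x ∶ A) → LKt (M , x ∶ neg A) → LKt M
    cutᴸ A D E =
      cut-via (λ M x → LKt (M , x ∶ neg A)) insert-map
        (λ E p → cut-via (λ M x → Premises M x A) Premises-map (principal A) E p)
        D E

    principal : ∀ A {M x} → Premises M x A → Premises M x (neg A) → LKt M
    principal (atom a)  (atom m)  (natom m′) = rule m (natom m′)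
    principal (natom a) (natom m) (atom m′)  = rule m (atom m′)
    -- The disjuncts are cut in turn: `A` is made outermost and removed while `B` is still present.
    principal (A ∨' B) (or D) (and E F) = cutᴸ B (cutᴸ A (exchange D) (insert-map insert↪ E)) F
    principal (A ∧' B) (and D E) (or F) = cutᴸ B E (cutᴸ A (insert-map insert↪ D) (exchange F))
    principal (box d A) (box D) (dia w c E) = cutᴸ A (LKt-map (collapse (_ , w , c)) D) E
    principal (dia d A) (dia w c D) (box E) = cutᴸ A D (LKt-map (collapse (_ , w , c)) E)

    exchange : ∀ {M x y A B} → LKt (M , x ∶ A , y ∶ B) → LKt (M , y ∶ B , x ∶ A)
    exchange = LKt-map (embed record { on = λ x → x ; edge = λ r → r
                                     ; fact = λ { (old (old m)) → old (old m) ; (old new) → new ; new → old new } })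

  -- Interpretation of SKt in the labelled calculus

  mutual
    -- Maps the tree of a sequent into `M`. Different subtrees may share their image, and edges may
    -- be followed against their direction.
    data Sat (M : Model) (x : World M) : Item → Set where
      fml  : ∀ {A} → Fact M x A → Sat M x (fml A)
      nest : ∀ {d y Δ} → Step (Edgeᴹ M) x d y → All (Sat M y) Δ → Sat M x (nest d Δ)

  Sats : (M : Model) → World M → Seq → Set
  Sats M x = All (Sat M x)

  mutual
    Sat-map : ∀ {N M x i} (ι : N ↪ M) → Sat N x i → Sat M (on ι x) i
    Sat-map ι (fml m)    = fml (fact ι m)
    Sat-map ι (nest r S) = nest (Step-map ι r) (Sats-map ι S)

    Sats-map : ∀ {N M x Γ} (ι : N ↪ M) → Sats N x Γ → Sats M (on ι x) Γ
    Sats-map ι []      = []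
    Sats-map ι (s ∷ S) = Sat-map ι s ∷ Sats-map ι S

  mutual
    Sats-≈ : ∀ {M x Γ Γ′} → Γ ≈ Γ′ → Sats M x Γ′ → Sats M x Γ
    Sats-≈ []           S           = S
    Sats-≈ (e ∷ es)     (s ∷ S)     = Sat-≈ e s ∷ Sats-≈ es S
    Sats-≈ (swap _ _ _) (s ∷ t ∷ S) = t ∷ s ∷ S
    Sats-≈ (trans e e′) S           = Sats-≈ e (Sats-≈ e′ S)

    Sat-≈ : ∀ {M x i j} → i ≈I j → Sat M x j → Sat M x i
    Sat-≈ (fmlI A)    s          = s
    Sat-≈ (nestI d e) (nest r S) = nest r (Sats-≈ e S)

  Sats-nests : ∀ {M x} ds {Δ} → Sats M x (nests ds Δ) → ∃ λ y → Walk (Edgeᴹ M) x ds y × Sats M y Δ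
  Sats-nests []       S = _ , [] , S
  Sats-nests (d ∷ ds) (nest r S ∷ []) with Sats-nests ds S
  ... | y , w , S′ = y , r ∷ w , S′

  disconnect : ∀ {M x d y} → Linked M x d y → Hom (connect M x d y) M
  disconnect l .at x = x
  disconnect l .link (old r) = _ , fwd r ∷ [] , refl◇ _
  disconnect l .link new = l
  disconnect l .fact m = inj₁ m

  -- All models and all roots are quantified over, because premises are interpreted with another
  -- root, another map or an enlarged model.
  SKt⇒LKt : ∀ {Γ} → SKt P Γ → ∀ {M x} → Sats M x Γ → LKt M
  SKt⇒LKt (id Γ a) S with ++⁻ Γ S
  ... | _ , fml m ∷ fml m′ ∷ [] = rule m (atom m′)
  SKt⇒LKt (cut Γ A D E) {M} {x} S =
    cutᴸ A {x = x} (SKt⇒LKt D (++⁺ (Sats-map insert↪ S) (fml new ∷ [])))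
                   (SKt⇒LKt E (++⁺ (Sats-map insert↪ S) (fml new ∷ [])))
  SKt⇒LKt (∧r Γ A B D E) S with ++⁻ Γ S
  ... | T , fml m ∷ [] = rule m (and (SKt⇒LKt D (++⁺ (Sats-map insert↪ T) (fml new ∷ [])))
                                     (SKt⇒LKt E (++⁺ (Sats-map insert↪ T) (fml new ∷ []))))
  SKt⇒LKt (∨r Γ A B D) S with ++⁻ Γ S
  ... | T , fml m ∷ [] =
    rule m (or (SKt⇒LKt D (++⁺ (Sats-map insert↪ (Sats-map insert↪ T)) (fml (old new) ∷ fml new ∷ []))))
  SKt⇒LKt (ctr Γ Δ D) S with ++⁻ Γ S
  -- Both copies of `Δ` receive the same image.
  ... | T , U = SKt⇒LKt D (++⁺ T (++⁺ U U))
  SKt⇒LKt (wk Γ Δ D) S = SKt⇒LKt D (proj₁ (++⁻ Γ S))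
  -- The root moves to the image of the nested node, and the edge is read backwards.
  SKt⇒LKt (rf Γ Δ D) (nest r S ∷ T) = SKt⇒LKt D (++⁺ S (nest (Step-sym r) T ∷ []))
  SKt⇒LKt (rp Γ Δ D) (nest r S ∷ T) = SKt⇒LKt D (++⁺ S (nest (Step-sym r) T ∷ []))
  SKt⇒LKt (boxr Γ d A D) S with ++⁻ Γ S
  ... | T , fml m ∷ [] =
    rule m (box (SKt⇒LKt D (++⁺ (Sats-map insert↪ (Sats-map attach↪ T)) (nest (fwd new) (fml new ∷ []) ∷ []))))
  SKt⇒LKt (diar Γ Δ d A D) S with ++⁻ Γ S
  ... | T , nest r U ∷ fml m ∷ [] =
    rule m (dia (r ∷ []) (refl◇ d)
      (SKt⇒LKt D (++⁺ (Sats-map insert↪ T) (nest r (++⁺ (Sats-map insert↪ U) (fml new ∷ [])) ∷ []))))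
  SKt⇒LKt (path Γ Δ ds d p D) S with ++⁻ Γ S
  ... | T , U with Sats-nests ds U
  -- The premise needs a `d`-edge to the end of the walk `w`. It is added for the premise and then
  -- replaced by `w`, which the axiom allows.
  ... | y , w , V = LKt-map (disconnect (ds , w , base (inj₁ p)))
                      (SKt⇒LKt D (++⁺ (Sats-map connect↪ T) (nest (fwd new) (Sats-map connect↪ V) ∷ [])))
  SKt⇒LKt (perm e D) S = SKt⇒LKt D (Sats-≈ e S)

-- From labelled derivations to DKt

mutual
  ≈-refl : ∀ {Γ} → Γ ≈ Γ
  ≈-refl {[]}    = []
  ≈-refl {_ ∷ _} = ≈I-refl ∷ ≈-refl

  ≈I-refl : ∀ {i} → i ≈I i
  ≈I-refl {fml A}    = fmlI A
  ≈I-refl {nest d Δ} = nestI d ≈-refl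

mutual
  ≈-sym : ∀ {Γ Δ} → Γ ≈ Δ → Δ ≈ Γ
  ≈-sym []           = []
  ≈-sym (e ∷ es)     = ≈I-sym e ∷ ≈-sym es
  ≈-sym (swap x y Γ) = swap y x Γ
  ≈-sym (trans e e′) = trans (≈-sym e′) (≈-sym e)

  ≈I-sym : ∀ {i j} → i ≈I j → j ≈I i
  ≈I-sym (fmlI A)    = fmlI A
  ≈I-sym (nestI d e) = nestI d (≈-sym e)

↭⇒≈ : ∀ {Γ Δ} → Γ ↭ Δ → Γ ≈ Δ
↭⇒≈ refl         = ≈-refl
↭⇒≈ (prep x p)   = ≈I-refl ∷ ↭⇒≈ p
↭⇒≈ (swap x y p) = trans (swap x y _) (≈I-refl ∷ ≈I-refl ∷ ↭⇒≈ p)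
↭⇒≈ (trans p q)  = trans (↭⇒≈ p) (↭⇒≈ q)

++-congˡ : ∀ Γ {Δ Δ′} → Δ ≈ Δ′ → (Γ ++ Δ) ≈ (Γ ++ Δ′)
++-congˡ []      e = e
++-congˡ (_ ∷ Γ) e = ≈I-refl ∷ ++-congˡ Γ e

plug-cong : ∀ c {Δ Δ′} → Δ ≈ Δ′ → plug c Δ ≈ plug c Δ′
plug-cong (hole Γ)       e = ++-congˡ Γ e
plug-cong (inNest Γ d c) e = ++-congˡ Γ (nestI d (plug-cong c e) ∷ [])

addAt-[] : ∀ Γ p → addAt Γ p [] ≡ Γ
addAt-[] Γ              []          = ++-identityʳ Γ
addAt-[] []             (_ ∷ _)     = refl
addAt-[] (x ∷ Γ)        (suc k ∷ p) = cong (x ∷_) (addAt-[] Γ (k ∷ p))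
addAt-[] (fml A ∷ Γ)    (zero ∷ p)  = refl
addAt-[] (nest d Θ ∷ Γ) (zero ∷ p)  = cong (λ Δ → nest d Δ ∷ Γ) (addAt-[] Θ p)

widen : Item → Ctx → Ctx
widen x (hole Γ)       = hole (x ∷ Γ)
widen x (inNest Γ d c) = inNest (x ∷ Γ) d c

plug-widen : ∀ x c Δ → plug (widen x c) Δ ≡ x ∷ plug c Δ
plug-widen x (hole Γ)       Δ = refl
plug-widen x (inNest Γ d c) Δ = refl

narrow : Ctx → Seq → Ctx
narrow (hole Γ)       Δ = hole (Γ ++ Δ)
narrow (inNest Γ d c) Δ = inNest Γ d (narrow c Δ)

plug-narrow : ∀ c Δ Ξ → plug (narrow c Δ) Ξ ≡ plug c (Δ ++ Ξ)
plug-narrow (hole Γ)       Δ Ξ = ++-assoc Γ Δ Ξ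
plug-narrow (inNest Γ d c) Δ Ξ = cong (λ Θ → Γ ++ nest d Θ ∷ []) (plug-narrow c Δ Ξ)

-- The context is independent of `q`, so it serves a node together with all its descendants.
context-at : ∀ {Γ Θ} p → node Γ p ≡ just Θ →
             ∃ λ c → ∀ q Δ → addAt Γ (p ++ q) Δ ≈ plug c (addAt Θ q Δ)
context-at []          refl = hole [] , λ q Δ → ≈-refl
context-at {fml A ∷ Γ} (suc k ∷ p) eq with context-at {Γ} (k ∷ p) eq
... | c , f = widen (fml A) c ,
  λ q Δ → subst (_ ≈_) (sym (plug-widen _ c _)) (≈I-refl ∷ f q Δ)
context-at {nest d Θ ∷ Γ} (suc k ∷ p) eq with context-at {Γ} (k ∷ p) eq
... | c , f = widen (nest d Θ) c ,
  λ q Δ → subst (_ ≈_) (sym (plug-widen _ c _)) (≈I-refl ∷ f q Δ)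
context-at {nest d Θ ∷ Γ} (zero ∷ p) eq with context-at {Θ} p eq
... | c , f = inNest Γ d c ,
  -- In a `Ctx` the nest around the hole comes last, so it is moved past its siblings.
  λ q Δ → trans (nestI d (f q Δ) ∷ ≈-refl) (↭⇒≈ (∷↭∷ʳ _ Γ))

-- Extension by appending at the ends of nodes only, so that old addresses stay valid.
data _⊑_ : Seq → Seq → Set where
  []⊑   : ∀ {Γ} → [] ⊑ Γ
  fml∷  : ∀ {A Γ Γ′} → Γ ⊑ Γ′ → (fml A ∷ Γ) ⊑ (fml A ∷ Γ′)
  nest∷ : ∀ {d Δ Δ′ Γ Γ′} → Δ ⊑ Δ′ → Γ ⊑ Γ′ → (nest d Δ ∷ Γ) ⊑ (nest d Δ′ ∷ Γ′)

⊑-refl : ∀ {Γ} → Γ ⊑ Γ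
⊑-refl {[]}           = []⊑
⊑-refl {fml A ∷ Γ}    = fml∷ ⊑-refl
⊑-refl {nest d Δ ∷ Γ} = nest∷ ⊑-refl ⊑-refl

⊑-++ : ∀ {Γ Δ} → Γ ⊑ (Γ ++ Δ)
⊑-++ {[]}           = []⊑
⊑-++ {fml A ∷ Γ}    = fml∷ ⊑-++
⊑-++ {nest d Δ ∷ Γ} = nest∷ ⊑-refl ⊑-++

addAt-⊑ : ∀ Γ p Δ → Γ ⊑ addAt Γ p Δ
addAt-⊑ Γ              []          Δ = ⊑-++
addAt-⊑ []             (_ ∷ _)     Δ = []⊑
addAt-⊑ (fml A ∷ Γ)    (suc k ∷ p) Δ = fml∷ (addAt-⊑ Γ (k ∷ p) Δ)
addAt-⊑ (nest d Θ ∷ Γ) (suc k ∷ p) Δ = nest∷ ⊑-refl (addAt-⊑ Γ (k ∷ p) Δ)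
addAt-⊑ (fml A ∷ Γ)    (zero ∷ _)  Δ = ⊑-refl
addAt-⊑ (nest d Θ ∷ Γ) (zero ∷ p)  Δ = nest∷ (addAt-⊑ Θ p Δ) ⊑-refl

∈-⊑ : ∀ {Γ Γ′ A} → Γ ⊑ Γ′ → fml A ∈ Γ → fml A ∈ Γ′
∈-⊑ (fml∷ e)    (here refl) = here refl
∈-⊑ (fml∷ e)    (there m)   = there (∈-⊑ e m)
∈-⊑ (nest∷ _ e) (there m)   = there (∈-⊑ e m)

nth-⊑ : ∀ {Γ Γ′ d Δ} k → Γ ⊑ Γ′ → nth Γ k ≡ just (nest d Δ) → ∃ λ Δ′ → nth Γ′ k ≡ just (nest d Δ′)
nth-⊑ zero    (nest∷ _ _) refl = _ , refl
nth-⊑ (suc k) (fml∷ e)    eq   = nth-⊑ k e eq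
nth-⊑ (suc k) (nest∷ _ e) eq   = nth-⊑ k e eq

node-⊑ : ∀ {Γ Γ′ Θ} p → Γ ⊑ Γ′ → node Γ p ≡ just Θ → ∃ λ Θ′ → node Γ′ p ≡ just Θ′ × Θ ⊑ Θ′
node-⊑ []          e           refl = _ , refl , e
node-⊑ (suc k ∷ p) (fml∷ e)    eq   = node-⊑ (k ∷ p) e eq
node-⊑ (suc k ∷ p) (nest∷ _ e) eq   = node-⊑ (k ∷ p) e eq
node-⊑ (zero ∷ p)  (nest∷ e _) eq   = node-⊑ p e eq

node-addAt : ∀ Γ {Θ} p Δ → node Γ p ≡ just Θ → node (addAt Γ p Δ) p ≡ just (Θ ++ Δ)
node-addAt Γ                []          Δ refl = refl
node-addAt (fml _ ∷ Γ)      (suc k ∷ p) Δ eq   = node-addAt Γ (k ∷ p) Δ eq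
node-addAt (nest _ _ ∷ Γ)   (suc k ∷ p) Δ eq   = node-addAt Γ (k ∷ p) Δ eq
node-addAt (nest _ Θ ∷ Γ)   (zero ∷ p)  Δ eq   = node-addAt Θ p Δ eq

node-child : ∀ Γ {Θ k d Δ} p → node Γ p ≡ just Θ → nth Θ k ≡ just (nest d Δ) →
             node Γ (p ++ k ∷ []) ≡ just Δ
node-child (nest _ _ ∷ Γ) {k = zero}  []          refl refl = refl
node-child (fml _ ∷ Γ)    {k = suc k} []          refl eq′ = node-child Γ {k = k} [] refl eq′
node-child (nest _ _ ∷ Γ) {k = suc k} []          refl eq′ = node-child Γ {k = k} [] refl eq′
node-child (fml _ ∷ Γ)                (suc j ∷ p) eq eq′ = node-child Γ (j ∷ p) eq eq′
node-child (nest _ _ ∷ Γ)             (suc j ∷ p) eq eq′ = node-child Γ (j ∷ p) eq eq′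
node-child (nest _ Θ ∷ Γ)             (zero ∷ p)  eq eq′ = node-child Θ p eq eq′

nth-last : ∀ Γ {i} → nth (Γ ++ i ∷ []) (length Γ) ≡ just i
nth-last []      = refl
nth-last (_ ∷ Γ) = nth-last Γ

Edge-⊑ : ∀ {Γ Γ′ p d q} → Γ ⊑ Γ′ → Edge Γ p d q → Edge Γ′ p d q
Edge-⊑ e (down {p = p} {k = k} n c) with node-⊑ p e n
... | _ , n′ , e′ = down n′ (proj₂ (nth-⊑ k e′ c))
Edge-⊑ e (up {p = p} {k = k} n c) with node-⊑ p e n
... | _ , n′ , e′ = up n′ (proj₂ (nth-⊑ k e′ c))

Edge-sym : ∀ {Γ p d q} → Edge Γ p d q → Edge Γ q (inv d) p
Edge-sym (down n c) = up n c
Edge-sym {Γ} (up {d = d} n c) = subst (λ e → Edge Γ _ e _) (sym (inv-involutive d)) (down n c)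

data Holds (Γ : Seq) (p : Addr) (A : Fml) : Set where
  holds : ∀ {Θ} → node Γ p ≡ just Θ → fml A ∈ Θ → Holds Γ p A

Holds-⊑ : ∀ {Γ Γ′ A} p → Γ ⊑ Γ′ → Holds Γ p A → Holds Γ′ p A
Holds-⊑ p e (holds n m) with node-⊑ p e n
... | _ , n′ , e′ = holds n′ (∈-⊑ e′ m)

Holds-addAt : ∀ {Γ Θ A} p Δ → node Γ p ≡ just Θ → fml A ∈ Δ → Holds (addAt Γ p Δ) p A
Holds-addAt {Θ = Θ} p Δ n m = holds (node-addAt _ p Δ n) (∈-++⁺ʳ Θ m)

∈⇒↭ : ∀ {i : Item} {Γ} → i ∈ Γ → ∃ λ Γ′ → Γ ↭ i ∷ Γ′
∈⇒↭ m with ∈-∃++ m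
... | Γ₁ , Γ₂ , refl = Γ₁ ++ Γ₂ , shift _ Γ₁ Γ₂

-- Puts the principal items `Δ` beside the hole, as the rules of DKt expect; one context serves the
-- conclusion (`Ξ` empty) and the premises.
context-of : ∀ {Γ Θ} p Δ {Θ′} → node Γ p ≡ just Θ → Θ ↭ Δ ++ Θ′ →
             ∃ λ c → ∀ Ξ → addAt Γ p Ξ ≈ plug c (Δ ++ Ξ)
context-of {Γ} {Θ} p Δ {Θ′} n e with context-at {Γ} p n
... | c , f = narrow c Θ′ , λ Ξ →
  subst (_ ≈_) (sym (plug-narrow c Θ′ (Δ ++ Ξ)))
    (trans (subst (λ q → addAt Γ q Ξ ≈ plug c (Θ ++ Ξ)) (++-identityʳ p) (f [] Ξ))
           (plug-cong c (trans (≈-++ʳ (↭⇒≈ (trans e (++-comm Δ Θ′)))) (↭⇒≈ (↭-reflexive (++-assoc Θ′ Δ Ξ))))))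
  where
  ≈-++ʳ : ∀ {Γ Γ′ Δ} → Γ ≈ Γ′ → (Γ ++ Δ) ≈ (Γ′ ++ Δ)
  ≈-++ʳ []           = ≈-refl
  ≈-++ʳ (e ∷ es)     = e ∷ ≈-++ʳ es
  ≈-++ʳ (swap x y Γ) = swap x y _
  ≈-++ʳ (trans e e′) = trans (≈-++ʳ e) (≈-++ʳ e′)

context-of-fml : ∀ {Γ p A} → Holds Γ p A → ∃ λ c → ∀ Ξ → addAt Γ p Ξ ≈ plug c (fml A ∷ Ξ)
context-of-fml {p = p} (holds n m) = context-of p (fml _ ∷ []) n (proj₂ (∈⇒↭ m))

-- Here the model is mapped into the tree of `Γ`, opposite to `Sat`; `Γ` may contain more than the
-- image.
record _⊩_ (Γ : Seq) (M : Model) : Set where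
  field
    pos    : World M → Addr
    isNode : ∀ x → ∃ λ Θ → node Γ (pos x) ≡ just Θ
    edge   : ∀ {x d y} → Edgeᴹ M x d y → Edge Γ (pos x) d (pos y)
    fact   : ∀ {x A} → Fact M x A → Holds Γ (pos x) A

open _⊩_

⊩-⊑ : ∀ {Γ Γ′ M} → Γ ⊑ Γ′ → Γ ⊩ M → Γ′ ⊩ M
⊩-⊑ e ρ .pos = pos ρ
⊩-⊑ e ρ .isNode x with node-⊑ (pos ρ x) e (proj₂ (isNode ρ x))
... | _ , n , _ = _ , n
⊩-⊑ e ρ .edge r = Edge-⊑ e (edge ρ r)
⊩-⊑ e ρ .fact m = Holds-⊑ _ e (fact ρ m)

⊩-insert : ∀ {Γ M x A} (ρ : Γ ⊩ M) → Holds Γ (pos ρ x) A → Γ ⊩ (M , x ∶ A)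
⊩-insert ρ h .pos          = pos ρ
⊩-insert ρ h .isNode       = isNode ρ
⊩-insert ρ h .edge         = edge ρ
⊩-insert ρ h .fact (old m) = fact ρ m
⊩-insert ρ h .fact new     = h

⊩-attach : ∀ {Γ M x d q} (ρ : Γ ⊩ M) → (∃ λ Δ → node Γ q ≡ just Δ) → Edge Γ (pos ρ x) d q → Γ ⊩ (M ▸ x , d)
⊩-attach ρ n r .pos (just x) = pos ρ x
⊩-attach {q = q} ρ n r .pos nothing = q
⊩-attach ρ n r .isNode (just x) = isNode ρ x
⊩-attach ρ n r .isNode nothing  = n
⊩-attach ρ n r .edge (old r′) = edge ρ r′
⊩-attach ρ n r .edge new      = r
⊩-attach ρ n r .fact (old m) = fact ρ m

⊩-addAt : ∀ {Γ M} (ρ : Γ ⊩ M) x Δ → addAt Γ (pos ρ x) Δ ⊩ M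
⊩-addAt {Γ} ρ x Δ = ⊩-⊑ (addAt-⊑ Γ (pos ρ x) Δ) ρ

⊩-addAt-holds : ∀ {Γ M} (ρ : Γ ⊩ M) x Δ {A} → fml A ∈ Δ → Holds (addAt Γ (pos ρ x) Δ) (pos ρ x) A
⊩-addAt-holds ρ x Δ = Holds-addAt (pos ρ x) Δ (proj₂ (isNode ρ x))

path-of : ∀ {Γ M x s y} (ρ : Γ ⊩ M) → Walk (Edgeᴹ M) x s y → Path Γ (pos ρ x) s (pos ρ y)
path-of ρ []          = []
path-of ρ (fwd r ∷ w) = edge ρ r ∷ path-of ρ w
path-of ρ (bwd r ∷ w) = Edge-sym (edge ρ r) ∷ path-of ρ w

module _ (P : PathAx → Set) where

  perm-addAt : ∀ {Γ} p {Δ} → addAt Γ p [] ≈ Δ → DKt P Δ → DKt P Γ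
  perm-addAt {Γ} p e D = subst (DKt P) (addAt-[] Γ p) (perm (≈-sym e) D)

  axiom-at : ∀ {Γ p a} → Holds Γ p (atom a) → Holds Γ p (natom a) → DKt P Γ
  axiom-at {Γ} {p} {a} (holds n m) (holds n′ m′) with node Γ p in eq
  axiom-at {Γ} {p} {a} (holds refl m) (holds refl m′) | _ with ∈⇒↭ m
  ... | Θ′ , e with ∈-resp-↭ e m′
  ... | there m″ with ∈⇒↭ m″
  ... | Θ″ , e′ with context-of {Γ} p (fml (atom a) ∷ fml (natom a) ∷ []) eq (trans e (prep _ e′))
  ... | c , f = perm-addAt p (f []) (id c a)

  -- The rules used keep their principal formula, so premises only extend `Γ` and the realisation
  -- survives; the labelled diamond rule becomes `prop`.
  LKt⇒DKt : ∀ {Γ M} → LKt P M → Γ ⊩ M → DKt P Γ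
  LKt⇒DKt (rule m (atom m′))  ρ = axiom-at (fact ρ m) (fact ρ m′)
  LKt⇒DKt (rule m (natom m′)) ρ = axiom-at (fact ρ m′) (fact ρ m)
  LKt⇒DKt {Γ} (rule {x} m (and {A} {B} D E)) ρ with context-of-fml (fact ρ m)
  ... | c , f = perm-addAt (pos ρ x) (f []) (∧r c A B
    (perm (f _) (LKt⇒DKt D (⊩-insert (⊩-addAt ρ x _) (⊩-addAt-holds ρ x _ (here refl)))))
    (perm (f _) (LKt⇒DKt E (⊩-insert (⊩-addAt ρ x _) (⊩-addAt-holds ρ x _ (here refl))))))
  LKt⇒DKt {Γ} (rule {x} m (or {A} {B} D)) ρ with context-of-fml (fact ρ m)
  ... | c , f = perm-addAt (pos ρ x) (f []) (∨r c A B
    (perm (f _) (LKt⇒DKt D (⊩-insert (⊩-insert (⊩-addAt ρ x _)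
      (⊩-addAt-holds ρ x _ (here refl))) (⊩-addAt-holds ρ x _ (there (here refl)))))))
  LKt⇒DKt {Γ} (rule {x} m (box {d} {A} D)) ρ with context-of-fml (fact ρ m) | isNode ρ x
  ... | c , f | Θ , n = perm-addAt (pos ρ x) (f []) (boxr c d A
    (perm (f _) (LKt⇒DKt D (⊩-insert (⊩-attach (⊩-addAt ρ x _) (_ , n″) (down n′ (nth-last Θ)))
      (holds n″ (here refl))))))
    where
    -- The new leaf is appended to `Θ`, so its child index is `length Θ`.
    n′ = node-addAt Γ (pos ρ x) (nest d (fml A ∷ []) ∷ []) n
    n″ = node-child (addAt Γ (pos ρ x) _) (pos ρ x) n′ (nth-last Θ)
  LKt⇒DKt {Γ} (rule {x} m (dia {d} {A} {s} {y} w c D)) ρ with fact ρ m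
  ... | holds n m′ = prop Γ (pos ρ x) (pos ρ y) s d A n m′ (path-of ρ w) c
    (LKt⇒DKt D (⊩-insert (⊩-addAt ρ y _) (⊩-addAt-holds ρ y _ (here refl))))

-- The tree of a sequent as a model

treeModel : Seq → Model
treeModel Γ = model (∃ λ p → ∃ λ Θ → node Γ p ≡ just Θ)
                    (λ x d y → Edge Γ (proj₁ x) d (proj₁ y))
                    (λ x A → Holds Γ (proj₁ x) A)

treeModel-⊩ : ∀ Γ → Γ ⊩ treeModel Γ
treeModel-⊩ Γ = record { pos = proj₁ ; isNode = proj₂ ; edge = λ r → r ; fact = λ h → h }

treeModel-sat : ∀ P Γ → Sats P (treeModel Γ) ([] , Γ , refl) Γ
treeModel-sat P Γ = satNode Γ refl
  where
  mutual
    satNode : ∀ Θ {p} (n : node Γ p ≡ just Θ) → Sats P (treeModel Γ) (p , Θ , n) Θ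
    satNode Θ {p} n = satItems Θ (λ m → holds n m) (λ k c → _ , down n c , node-child Γ p n c)

    -- Facts and children are passed as hypotheses, so the induction can run over suffixes of a
    -- node's item list with shifted indices.
    satItems : ∀ Ξ {x} → (∀ {A} → fml A ∈ Ξ → Holds Γ (proj₁ x) A) →
               (∀ k {d Δ} → nth Ξ k ≡ just (nest d Δ) → ∃ λ q → Edge Γ (proj₁ x) d q × node Γ q ≡ just Δ) →
               Sats P (treeModel Γ) x Ξ
    satItems [] h g = []
    satItems (fml A ∷ Ξ) h g = fml (h (here refl)) ∷ satItems Ξ (λ m → h (there m)) (λ k → g (suc k))
    satItems (nest d Δ ∷ Ξ) h g with g zero refl
    ... | q , r , n = nest (fwd r) (satNode Δ n) ∷ satItems Ξ (λ m → h (there m)) (λ k → g (suc k))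

SKt⇒DKt : ∀ P {Γ} → SKt P Γ → DKt P Γ
SKt⇒DKt P {Γ} D = LKt⇒DKt P (SKt⇒LKt P D (treeModel-sat P Γ)) (treeModel-⊩ Γ)

-- Display in SKt and soundness of DKt

nests-++ : ∀ s t Δ → nests (s ++ t) Δ ≡ nests s (nests t Δ)
nests-++ []      t Δ = refl
nests-++ (d ∷ s) t Δ = cong (λ Θ → nest d Θ ∷ []) (nests-++ s t Δ)

dias boxes : List Dia → Fml → Fml
dias s A  = foldr dia A s
boxes s A = foldr box A s

neg-dias : ∀ s A → neg (dias s A) ≡ boxes s (neg A)
neg-dias []      A = refl
neg-dias (d ∷ s) A = cong (box d) (neg-dias s A)

nth-split : ∀ {Θ d Δ} k → nth Θ k ≡ just (nest d Δ) →
            ∃ λ Θ′ → Θ ↭ nest d Δ ∷ Θ′ × (∀ Ξ → addAt Θ (k ∷ []) Ξ ↭ nest d (Δ ++ Ξ) ∷ Θ′)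
nth-split {nest d Δ ∷ Θ} zero    refl = Θ , refl , λ Ξ → refl
nth-split {i ∷ Θ}        (suc k) eq with nth-split {Θ} k eq
... | Θ′ , e , f = i ∷ Θ′ , trans (prep i e) (swap _ _ refl) , λ Ξ → trans (addAt-suc i) (trans (prep i (f Ξ)) (swap _ _ refl))
  where
  addAt-suc : ∀ i {Ξ} → addAt (i ∷ Θ) (suc k ∷ []) Ξ ↭ i ∷ addAt Θ (k ∷ []) Ξ
  addAt-suc (fml _)    = refl
  addAt-suc (nest _ _) = refl

module _ (P : PathAx → Set) where

  perm↭ : ∀ {Γ Δ} → Γ ↭ Δ → SKt P Γ → SKt P Δ
  perm↭ e = perm (↭⇒≈ e)

  perm⇔ : ∀ {Γ Δ} → Γ ≈ Δ → SKt P Γ ⇔ SKt P Δ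
  perm⇔ e = mk⇔ (perm e) (perm (≈-sym e))

  rotateˡ : ∀ Γ Δ → SKt P (Γ ++ Δ) → SKt P (Δ ++ Γ)
  rotateˡ Γ Δ = perm↭ (++-comm Γ Δ)

  -- The mark `ʰ` denotes versions of the rules acting at the head of the sequent.
  cutʰ : ∀ A {Γ} → SKt P (fml A ∷ Γ) → SKt P (fml (neg A) ∷ Γ) → SKt P Γ
  cutʰ A {Γ} D E = cut Γ A (rotateˡ (_ ∷ []) Γ D) (rotateˡ (_ ∷ []) Γ E)

  wkʰ : ∀ Δ {Γ} → SKt P Γ → SKt P (Δ ++ Γ)
  wkʰ Δ {Γ} D = rotateˡ Γ Δ (wk Γ Δ D)

  ctrʰ : ∀ {i Γ} → SKt P (i ∷ i ∷ Γ) → SKt P (i ∷ Γ)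
  ctrʰ {i} {Γ} D = rotateˡ Γ (i ∷ []) (ctr Γ (i ∷ []) (rotateˡ (i ∷ i ∷ []) Γ D))

  exch : ∀ {i j Γ} → SKt P (i ∷ j ∷ Γ) → SKt P (j ∷ i ∷ Γ)
  exch = perm (swap _ _ _)

  andʰ : ∀ {A B Γ} → SKt P (fml A ∷ Γ) → SKt P (fml B ∷ Γ) → SKt P (fml (A ∧' B) ∷ Γ)
  andʰ {Γ = Γ} D E = rotateˡ Γ _ (∧r Γ _ _ (rotateˡ (_ ∷ []) Γ D) (rotateˡ (_ ∷ []) Γ E))

  orʰ : ∀ {A B Γ} → SKt P (fml A ∷ fml B ∷ Γ) → SKt P (fml (A ∨' B) ∷ Γ)
  orʰ {Γ = Γ} D = rotateˡ Γ _ (∨r Γ _ _ (rotateˡ (_ ∷ _ ∷ []) Γ D))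

  boxʰ : ∀ {d A Γ} → SKt P (nest d (fml A ∷ []) ∷ Γ) → SKt P (fml (box d A) ∷ Γ)
  boxʰ {Γ = Γ} D = rotateˡ Γ _ (boxr Γ _ _ (rotateˡ (_ ∷ []) Γ D))

  nest-comm : ∀ {d} Δ {Δ′ Γ} → SKt P (nest d (Δ ++ Δ′) ∷ Γ) → SKt P (nest d (Δ′ ++ Δ) ∷ Γ)
  nest-comm Δ {Δ′} = perm (nestI _ (↭⇒≈ (++-comm Δ Δ′)) ∷ ≈-refl)

  diaʰ : ∀ {d A Δ Γ} → SKt P (nest d (fml A ∷ Δ) ∷ Γ) → SKt P (nest d Δ ∷ fml (dia d A) ∷ Γ)
  diaʰ {d} {A} {Δ} {Γ} D = rotateˡ Γ _ (diar Γ Δ d A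
    (rotateˡ (_ ∷ []) Γ (nest-comm (fml A ∷ []) D)))

  pathʰ : ∀ {s d Δ Γ} → P (s , d) → SKt P (nest d Δ ∷ Γ) → SKt P (nests s Δ ++ Γ)
  pathʰ {s} {d} {Δ} {Γ} p D = rotateˡ Γ (nests s Δ) (path Γ Δ s d p (rotateˡ (_ ∷ []) Γ D))

  -- Treats `rf` and `rp` uniformly; turning at `inv d` undoes turning at `d`, so display is
  -- reversible.
  turn : ∀ d {Δ Γ} → SKt P (nest d Δ ∷ Γ) → SKt P (nest (inv d) Γ ∷ Δ)
  turn fut  {Δ} {Γ} D = rf Γ Δ (rotateˡ (_ ∷ []) Γ D)
  turn past {Δ} {Γ} D = rp Γ Δ (rotateˡ (_ ∷ []) Γ D)

  turn⁻ : ∀ d {Δ Γ} → SKt P (nest (inv d) Γ ∷ Δ) → SKt P (nest d Δ ∷ Γ)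
  turn⁻ d {Δ} {Γ} D = subst (λ e → SKt P (nest e Δ ∷ Γ)) (inv-involutive d) (turn (inv d) D)

  -- The diamond rule seen from the child: the nest is made the root, and the old root is its
  -- `inv d`-neighbour.
  diaʰ⁻ : ∀ {d A Δ Γ} → SKt P (nest d Δ ∷ fml A ∷ Γ) → SKt P (nest d (fml (dia (inv d) A) ∷ Δ) ∷ Γ)
  diaʰ⁻ {d} D = turn⁻ d (diaʰ (turn d D))

  boxdia : ∀ {d A B} → SKt P (fml A ∷ fml B ∷ []) → SKt P (fml (box d A) ∷ fml (dia d B) ∷ [])
  -- Turning a weakened-in empty nest puts the whole sequent under `d`, which is necessitation.
  boxdia {d} D = boxʰ (diaʰ (turn⁻ d (wkʰ (nest (inv d) [] ∷ []) (exch D))))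

  identity : ∀ A → SKt P (fml (neg A) ∷ fml A ∷ [])
  identity (atom a)  = exch (id [] a)
  identity (natom a) = id [] a
  identity (A ∨' B)  = exch (orʰ (rotateˡ (_ ∷ []) (fml A ∷ fml B ∷ []) (andʰ
    (rotateˡ (fml B ∷ []) (fml (neg A) ∷ fml A ∷ []) (wkʰ (fml B ∷ []) (identity A)))
    (exch (wkʰ (fml A ∷ []) (identity B))))))
  identity (A ∧' B)  = orʰ (rotateˡ (_ ∷ []) (fml (neg A) ∷ fml (neg B) ∷ []) (andʰ
    (rotateˡ (fml (neg B) ∷ []) (fml A ∷ fml (neg A) ∷ []) (wkʰ (fml (neg B) ∷ []) (exch (identity A))))
    (exch (wkʰ (fml (neg A) ∷ []) (exch (identity B))))))
  identity (box d A) = exch (boxdia (exch (identity A)))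
  identity (dia d A) = boxdia (identity A)

  implies : ∀ A B {Γ} → SKt P (fml (neg A) ∷ fml B ∷ []) → SKt P (fml A ∷ Γ) → SKt P (fml B ∷ Γ)
  implies A B {Γ} D E = cutʰ A (exch (wkʰ (fml B ∷ []) E))
    (rotateˡ Γ (_ ∷ _ ∷ []) (wkʰ Γ D))

  boxesʰ : ∀ s {A Γ} → SKt P (nests s (fml A ∷ []) ++ Γ) → SKt P (fml (boxes s A) ∷ Γ)
  boxesʰ []      D = D
  boxesʰ (d ∷ s) {A} {Γ} D = boxʰ (turn⁻ d (exch (boxesʰ s (rotateˡ (_ ∷ []) (nests s (fml A ∷ [])) (turn d D)))))

  -- Re-roots a chain of nests at its far end, turning once per edge.
  nests-converse : ∀ s {Δ Γ} → SKt P (nests s Δ ++ Γ) → SKt P (nests (converse s) Γ ++ Δ)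
  nests-converse [] {Δ} {Γ} D = rotateˡ Δ Γ D
  nests-converse (d ∷ s) {Δ} {Γ} D =
    subst (λ Θ → SKt P (Θ ++ Δ)) eq
      (nests-converse s (rotateˡ (_ ∷ []) (nests s Δ) (turn d D)))
    where
    eq : nests (converse s) (nest (inv d) Γ ∷ []) ≡ nests (converse (d ∷ s)) Γ
    eq rewrite unfold-reverse (inv d) (map inv s) = sym (nests-++ (converse s) (inv d ∷ []) Γ)

  dias-mono : ∀ s {A B} → SKt P (fml (neg A) ∷ fml B ∷ []) → SKt P (fml (neg (dias s A)) ∷ fml (dias s B) ∷ [])
  dias-mono []      D = D
  dias-mono (d ∷ s) D = boxdia (dias-mono s D)

  comp-sound : ∀ {s d} → Comp (P ∪I) (s , d) → ∀ A → SKt P (fml (neg (dias s A)) ∷ fml (dia d A) ∷ [])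
  comp-sound {s} {d} (base (inj₁ p)) A rewrite neg-dias s A =
    boxesʰ s (pathʰ p (diaʰ (turn⁻ d (wkʰ (_ ∷ []) (exch (identity A))))))
  comp-sound (base (inj₂ ((s , d) , p , refl))) A rewrite neg-dias (converse s) A =
    -- Seen from its far end the chain reads `s`, with the diamond formula at its bottom, so the
    -- rule of the uninverted axiom applies.
    boxesʰ (converse s) (nests-converse s
      (pathʰ p (diaʰ⁻ (wkʰ (nest d [] ∷ []) (exch (identity A))))))
  comp-sound (refl◇ d) A = identity (dia d A)
  comp-sound (compose {fs} {f} {gs₁} {gs₂} {g} c c′) A
    rewrite foldr-++ dia A gs₁ (fs ++ gs₂) | foldr-++ dia A fs gs₂ =
    -- The inner implication is applied under the prefix `gs₁` by monotonicity, then cut against the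
    -- outer one.
    exch (implies (dias (gs₁ ++ f ∷ gs₂) A) _ (comp-sound c′ A)
      (subst (λ B → SKt P (fml B ∷ _)) (sym (foldr-++ dia A gs₁ (f ∷ gs₂)))
        (exch (dias-mono gs₁ (comp-sound c (dias gs₂ A))))))

  -- Each turn brings the hole one level up and stores its surroundings in `Ξ`. As `Γ` does not
  -- depend on `Δ`, premises and conclusion are displayed alike.
  display : ∀ c Ξ → ∃ λ Γ → ∀ Δ → SKt P (plug c Δ ++ Ξ) ⇔ SKt P (Δ ++ Γ)
  display (hole Γ) Ξ = Γ ++ Ξ , λ Δ → perm⇔ (↭⇒≈ (trans (++⁺ʳ Ξ (++-comm Γ Δ)) (↭-reflexive (++-assoc Δ Γ Ξ))))
  display (inNest Γ d c) Ξ with display c (nest (inv d) (Γ ++ Ξ) ∷ [])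
  ... | Γ′ , f = Γ′ , λ Δ → f Δ ⇔-∘ (perm⇔ (↭⇒≈ (++-comm (_ ∷ []) (plug c Δ))) ⇔-∘
      (mk⇔ (turn d) (turn⁻ d) ⇔-∘ perm⇔ (↭⇒≈ (trans (↭-reflexive (++-assoc Γ _ Ξ)) (shift _ Γ Ξ)))))

  displayed : ∀ c → ∃ λ Γ → ∀ Δ → SKt P (plug c Δ) ⇔ SKt P (Δ ++ Γ)
  displayed c with display c []
  ... | Γ , f = Γ , λ Δ → subst (λ Θ → SKt P Θ ⇔ SKt P (Δ ++ Γ)) (++-identityʳ (plug c Δ)) (f Δ)

  -- Displaying the parent leaves the child at depth one, within reach of the shallow diamond rules;
  -- both ends share one `Ξ`.
  displayed-edge : ∀ {Γ Θ d Δ} p k → node Γ p ≡ just Θ → nth Θ k ≡ just (nest d Δ) →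
    ∃ λ Ξ → (∀ Φ → SKt P (addAt Γ p Φ) ⇔ SKt P (nest d Δ ∷ Φ ++ Ξ))
          × (∀ Φ → SKt P (addAt Γ (p ++ k ∷ []) Φ) ⇔ SKt P (nest d (Φ ++ Δ) ∷ Ξ))
  displayed-edge {Γ} {Θ} {d} {Δ} p k n eq with context-at {Γ} p n | nth-split k eq
  ... | c , f | Θ′ , e , h with displayed c
  ... | Ξ , g = Θ′ ++ Ξ ,
    (λ Φ → perm⇔ (↭⇒≈ (parent Φ)) ⇔-∘ (g _ ⇔-∘
      perm⇔ (subst (λ q → addAt Γ q Φ ≈ plug c (Θ ++ Φ)) (++-identityʳ p) (f [] Φ)))) ,
    (λ Φ → perm⇔ (trans (↭⇒≈ (++⁺ʳ Ξ (h Φ))) (nestI d (↭⇒≈ (++-comm Δ Φ)) ∷ ≈-refl)) ⇔-∘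
      (g _ ⇔-∘ perm⇔ (f (k ∷ []) Φ)))
    where
    parent : ∀ Φ → (Θ ++ Φ) ++ Ξ ↭ nest d Δ ∷ Φ ++ (Θ′ ++ Ξ)
    parent Φ = trans (++⁺ʳ Ξ (++⁺ʳ Φ e))
      (prep _ (trans (++⁺ʳ Ξ (++-comm Θ′ Φ)) (↭-reflexive (++-assoc Φ Θ′ Ξ))))

  edge-sound : ∀ {Γ p d q A} → Edge Γ p d q →
               SKt P (addAt Γ q (fml A ∷ [])) → SKt P (addAt Γ p (fml (dia d A) ∷ []))
  edge-sound (down {p} {k = k} n eq) D with displayed-edge p k n eq
  ... | _ , parent , child = from (parent _) (diaʰ (to (child _) D))
  edge-sound (up {p} {k = k} n eq) D with displayed-edge p k n eq
  ... | _ , parent , child = from (child _) (diaʰ⁻ (to (parent _) D))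

  -- Pulls `A` back from the end of the path, collecting one diamond per edge.
  path-sound : ∀ {Γ p s q A} → Path Γ p s q →
               SKt P (addAt Γ q (fml A ∷ [])) → SKt P (addAt Γ p (fml (dias s A) ∷ []))
  path-sound []      D = D
  path-sound (r ∷ w) D = edge-sound r (path-sound w D)

  DKt⇒SKt : ∀ {Γ} → DKt P Γ → SKt P Γ
  DKt⇒SKt (id c a) with displayed c
  ... | Γ , f = from (f _) (rotateˡ Γ _ (id Γ a))
  DKt⇒SKt (∧r c A B D E) with displayed c
  ... | Γ , f = from (f _) (ctrʰ (andʰ (exch (to (f _) (DKt⇒SKt D))) (exch (to (f _) (DKt⇒SKt E)))))
  DKt⇒SKt (∨r c A B D) with displayed c
  ... | Γ , f = from (f _) (ctrʰ (orʰ (perm↭ (↭-sym (shift _ (fml A ∷ fml B ∷ []) Γ)) (to (f _) (DKt⇒SKt D)))))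
  DKt⇒SKt (boxr c d A D) with displayed c
  ... | Γ , f = from (f _) (ctrʰ (boxʰ (exch (to (f _) (DKt⇒SKt D)))))
  DKt⇒SKt (dia₁ c Δ d A D) with displayed c
  ... | Γ , f = from (f _) (exch (ctrʰ (perm↭ (↭-sym (shift _ (fml (dia d A) ∷ fml (dia d A) ∷ []) Γ))
    (diaʰ (nest-comm Δ (to (f _) (DKt⇒SKt D)))))))
  DKt⇒SKt (dia₂ c Δ d A D) with displayed c
  -- The second copy of `◆` arises inside the nest, while contraction is shallow: the nest is turned
  -- out, contracted and turned back.
  ... | Γ , f = from (f _) (nest-comm (◆ ∷ []) (turn⁻ (inv d) (exch (ctrʰ (perm↭ (↭-sym (shift _ (◆ ∷ ◆ ∷ []) Δ))
    (turn (inv d) (nest-comm (◆ ∷ Δ) (subst (λ e → SKt P (nest (inv d) (fml (dia e A) ∷ Δ ++ ◆ ∷ []) ∷ Γ))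
      (inv-involutive d) (diaʰ⁻ (to (f _) (DKt⇒SKt D)))))))))))
    where
    ◆ = fml (dia d A)
  DKt⇒SKt (prop Γ i j s d A n m w c D) with context-of i (fml (dia d A) ∷ []) n (proj₂ (∈⇒↭ m))
  ... | Σ , e with displayed Σ
  -- `A` returns to node `i` as `dias s A`, is cut into `dia d A`, and is contracted with the
  -- occurrence already there.
  ... | Ξ , f = subst (SKt P) (addAt-[] Γ i) (perm (≈-sym (e [])) (from (f _)
    (ctrʰ (implies (dias s A) (dia d A) (comp-sound c A)
      (exch (to (f _) (perm (e _) (path-sound w (DKt⇒SKt D)))))))))
  DKt⇒SKt (perm e D) = perm e (DKt⇒SKt D)

theorem6p15 : (P : PathAx → Set) (Γ : Seq) → (SKt P Γ → DKt P Γ) × (DKt P Γ → SKt P Γ)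
theorem6p15 P Γ = SKt⇒DKt P , DKt⇒SKt P
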